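{- For $n\ge 0$ let $E(n)$ and $O(n)$ be the numbers of partitions of $n$ having even and odd pairing rank, respectively, and let $\operatorname{sc}(n)$ be the number of self-conjugate partitions of $n$. Then for every $n\geq 0$, $$E(n)-O(n)=(-1)^n\operatorname{sc}(n).$$
   Context: For an integer partition $\lambda$, pair equal parts of $\lambda$ as far as possible: for each part size occurring with odd multiplicity exactly one copy remains unpaired, and a part size of even multiplicity is completely paired. Let $r(\lambda)$ be the largest part size that participates in at least one pair (i.e. of multiplicity at least $2$), with $r(\lambda)=0$ if $\lambda$ has distinct parts. Write the unpaired parts (the part sizes of odd multiplicity, each once) in decreasing order $u_1>u_2>\cdots$ and let $s(\lambda)=u_1-u_2+u_3-u_4+\cdots$ (so $s(\lambda)=0$ if there are no unpaired parts). The pairing rank of $\lambda$ is $\rho(\lambda)=r(\lambda)-s(\lambda)$. A partition is self-conjugate if it equals its conjugate (transpose). -}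

module Defs where

open import Data.Nat.Base using (ℕ; zero; suc; _≤_; _<_; _≥_; z≤n; s≤s)
open import Data.Nat.Properties using (_≟_; _≤?_; _<?_; _≥?_; ≤-trans; m≤m+n; m≤n+m; +-mono-≤; suc-injective)
open import Data.Nat.Divisibility using (_∣_; _∣?_)
open import Data.Nat.ListAction using (sum)
open import Data.Integer.Base as ℤ using (ℤ; +_; 0ℤ; ∣_∣)
import Data.Integer.Divisibility as ℤ
open import Data.List.Base using (List; []; _∷_; length; filter; deduplicate; map; upTo; applyUpTo; cartesianProductWith)
open import Data.List.Properties using (≡-dec; ∷-injective)
open import Data.List.Extrema.Nat using (max)
open import Data.List.Membership.Propositional using (_∈_)
open import Data.List.Membership.Propositional.Properties using (∈-map⁺; ∈-upTo⁺; ∈-filter⁺; ∈-filter⁻; ∈-cartesianProductWith⁺; ∈-cartesianProductWith⁻)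
open import Data.List.Relation.Unary.Any using (here; there)
open import Data.List.Relation.Unary.All as All using (All; []; _∷_)
open import Data.List.Relation.Unary.AllPairs using ([]; _∷_)
open import Data.List.Relation.Unary.Linked using (Linked; linked?)
open import Data.List.Relation.Unary.Unique.Propositional using (Unique)
import Data.List.Relation.Unary.Unique.Propositional.Properties as Unique
open import Data.Product.Base using (_×_; _,_; proj₂)
open import Function.Base using (_∘_)
open import Function.Bundles using (_⇔_; mk⇔)
open import Relation.Binary.PropositionalEquality.Core using (_≡_; _≢_; refl)
open import Relation.Nullary.Decidable using (¬?; _×-dec_)
open import Relation.Nullary.Negation.Core using (¬_)
open import Relation.Unary using (Pred; Decidable)
open import Level using (0ℓ)

-- A partition is represented by the list of its parts, in weakly decreasing
-- order.
IsPartition : ℕ → List ℕ → Set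
IsPartition n ps = Linked _≥_ ps × All (0 <_) ps × sum ps ≡ n

isPartition? : ∀ n → Decidable (IsPartition n)
isPartition? n ps = linked? _≥?_ ps ×-dec All.all? (0 <?_) ps ×-dec (sum ps ≟ n)

-- All lists of length at most l with entries in {1,…,m}.
words : (m l : ℕ) → List (List ℕ)
words m zero    = [] ∷ []
words m (suc l) = [] ∷ cartesianProductWith _∷_ (map suc (upTo m)) (words m l)

-- A partition of n has at most n parts, each at most n, so every partition of n
-- occurs among these words; see ∈-partitions and partitions-unique below.
partitions : ℕ → List (List ℕ)
partitions n = filter (isPartition? n) (words n n)

∈-words : ∀ {m} l {ps} → All (0 <_) ps → All (_≤ m) ps → length ps ≤ l → ps ∈ words m l
∈-words zero    []            []           _         = here refl
∈-words (suc l) []            []           _         = here refl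
∈-words (suc l) (s≤s _ ∷ pos) (p≤m ∷ ps≤m) (s≤s len) =
  there (∈-cartesianProductWith⁺ _∷_ (∈-map⁺ suc (∈-upTo⁺ p≤m)) (∈-words l pos ps≤m len))

words-unique : ∀ m l → Unique (words m l)
words-unique m zero    = [] ∷ []
words-unique m (suc l) =
  All.tabulate []≢ ∷
  Unique.cartesianProductWith⁺ _∷_ ∷-injective
    (Unique.map⁺ suc-injective (Unique.upTo⁺ m)) (words-unique m l)
  where
  []≢ : ∀ {v} → v ∈ cartesianProductWith _∷_ (map suc (upTo m)) (words m l) → [] ≢ v
  []≢ v∈ refl with ∈-cartesianProductWith⁻ _∷_ (map suc (upTo m)) (words m l) v∈
  ... | _ , _ , _ , _ , ()

length≤sum : ∀ {ps} → All (0 <_) ps → length ps ≤ sum ps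
length≤sum []        = z≤n
length≤sum (p ∷ pos) = +-mono-≤ p (length≤sum pos)

parts≤sum : ∀ ps → All (_≤ sum ps) ps
parts≤sum []       = []
parts≤sum (p ∷ ps) = m≤m+n p (sum ps) ∷ All.map (λ q≤ → ≤-trans q≤ (m≤n+m (sum ps) p)) (parts≤sum ps)

∈-partitions : ∀ {n ps} → ps ∈ partitions n ⇔ IsPartition n ps
∈-partitions {n} {ps} = mk⇔ (proj₂ ∘ ∈-filter⁻ (isPartition? n) {xs = words n n}) complete
  where
  complete : IsPartition n ps → ps ∈ partitions n
  complete isP@(_ , pos , refl) =
    ∈-filter⁺ (isPartition? n) (∈-words n pos (parts≤sum ps) (length≤sum pos)) isP

partitions-unique : ∀ n → Unique (partitions n)
partitions-unique n = Unique.filter⁺ (isPartition? n) (words-unique n n)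

#partitions : {P : Pred (List ℕ) 0ℓ} → Decidable P → ℕ → ℕ
#partitions P? n = length (filter P? (partitions n))

multiplicity : ℕ → List ℕ → ℕ
multiplicity k ps = length (filter (k ≟_) ps)

-- The largest part size of multiplicity at least 2, or 0 if there is none.
r : List ℕ → ℕ
r ps = max 0 (filter (λ k → 2 ≤? multiplicity k ps) ps)

-- Both filter and deduplicate preserve the order of the list, so the unpaired
-- parts of a partition are listed in decreasing order.
unpaired : List ℕ → List ℕ
unpaired ps = deduplicate _≟_ (filter (λ k → ¬? (2 ∣? multiplicity k ps)) ps)

-- u₁ - (u₂ - (u₃ - ⋯)) = u₁ - u₂ + u₃ - ⋯
alternatingSum : List ℕ → ℤ
alternatingSum []       = 0ℤ
alternatingSum (u ∷ us) = + u ℤ.- alternatingSum us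

s : List ℕ → ℤ
s ps = alternatingSum (unpaired ps)

pairingRank : List ℕ → ℤ
pairingRank ps = + r ps ℤ.- s ps

EvenRank : Pred (List ℕ) 0ℓ
EvenRank ps = + 2 ℤ.∣ pairingRank ps

OddRank : Pred (List ℕ) 0ℓ
OddRank ps = ¬ EvenRank ps

evenRank? : Decidable EvenRank
evenRank? ps = 2 ∣? ∣ pairingRank ps ∣

oddRank? : Decidable OddRank
oddRank? ps = ¬? (evenRank? ps)

-- For i = 1, …, λ₁, the i-th part of the conjugate of λ is the number of parts
-- of λ that are at least i.
conjugate : List ℕ → List ℕ
conjugate ps = applyUpTo (λ i → length (filter (suc i ≤?_) ps)) (max 0 ps)

SelfConjugate : Pred (List ℕ) 0ℓ
SelfConjugate ps = conjugate ps ≡ ps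

selfConjugate? : Decidable SelfConjugate
selfConjugate? ps = ≡-dec _≟_ (conjugate ps) ps

E : ℕ → ℕ
E = #partitions evenRank?

O : ℕ → ℕ
O = #partitions oddRank?

sc : ℕ → ℕ
sc = #partitions selfConjugate?

{-# OPTIONS --safe #-}
-- The alternating sum s(λ) has the parity of |λ|, so the claim is Σ_{λ ⊢ n} (-1)^r(λ) = sc(n).
-- Splitting a partition into its pairs and its unpaired parts, the left side has generating function
--   F · Π (1 + qⁱ)  with  F = Σ_k (-1)ᵏ q^(2k) / (q²; q²)ₖ.
-- The series F_j = Σ_k (-1)ᵏ q^(2(j+1)k) / (q²; q²)ₖ satisfy (1 + q^(2(j+1))) F_j = F_{j+1} and tend
-- to 1, so F · Π (1 + q^(2i)) = 1 and the left side is Π (1 + q^(2i-1)).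
-- Removing the outermost hook, of odd size, shows that self-conjugate partitions have the same
-- generating function.
module Submission where

open import Defs
open import Data.Nat.Base using (ℕ)
open import Data.Integer.Base using (+_; _-_; _*_; _^_; -1ℤ)
open import Relation.Binary.PropositionalEquality.Core using (_≡_)

open import Algebra.Bundles using (AbelianGroup)
open import Data.Bool.Base using (if_then_else_)
open import Data.Empty using (⊥-elim)
open import Data.Integer.Base using (ℤ; _+_; -_; 0ℤ; 1ℤ)
open import Data.Integer.Divisibility.Signed using (_∣_; divides; ∣ᵤ⇒∣; ∣⇒∣ᵤ; ∣m∣n⇒∣m+n; ∣m∣n⇒∣m-n)
open import Data.Integer.Properties
open import Data.Integer.Tactic.RingSolver using (solve-∀)
open import Data.List.Base using (List; []; _∷_; _++_; map; length; filter; applyUpTo; drop)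
open import Data.List.Extrema.Nat using (max; max≈v⁺)
open import Data.List.Membership.Propositional using (_∈_; _∉_)
open import Data.List.Membership.Propositional.Properties
open import Data.List.Membership.Propositional.Properties.WithK using (unique∧set⇒bag)
open import Data.List.Properties
  using (filter-all; filter-accept; filter-reject; filter-none; ∷-injectiveʳ; map-id-local; map-∘)
open import Data.List.Relation.Binary.BagAndSetEquality using (∼bag⇒↭)
open import Data.List.Relation.Binary.Permutation.Propositional as ↭ using (_↭_)
open import Data.List.Relation.Unary.All as All using (All; []; _∷_)
import Data.List.Relation.Unary.All.Properties as All
open import Data.List.Relation.Unary.Any using (here; there)
open import Data.List.Relation.Unary.Linked as Linked using (Linked; []; [-]; _∷_)
import Data.List.Relation.Unary.Linked.Properties as Linked
open import Data.List.Relation.Unary.Unique.Propositional using (Unique; []; _∷_)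
import Data.List.Relation.Unary.Unique.Propositional.Properties as Unique
open import Data.Nat.Base as ℕ using (zero; suc; pred; _≤_; _<_; _≥_; z≤n; s≤s)
import Data.Nat.Divisibility as ℕ
open import Data.Nat.Induction using (<-rec)
open import Data.Nat.ListAction using (sum)
import Data.Nat.Properties as ℕ
open import Data.Product.Base using (_×_; _,_; proj₁; proj₂; ∃-syntax)
open import Data.Sum.Base using (inj₁; inj₂)
open import Function.Base using (_∘_; const)
open import Function.Bundles using (mk⇔; Equivalence)
open import Level using (0ℓ)
open import Relation.Binary.PropositionalEquality
open import Relation.Nullary.Decidable using (Dec; yes; no; does; ¬?)
open import Relation.Nullary.Negation using (¬_)
open import Relation.Unary using (Pred; Decidable)

open import Algebra.Properties.Group (AbelianGroup.group +-0-abelianGroup) using (∙-cancelʳ)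
import Algebra.Properties.CommutativeSemigroup ℕ.+-commutativeSemigroup as +
open import Data.List.Membership.DecPropositional ℕ._≟_ using (_∈?_)
open import Data.List.Relation.Unary.Unique.DecPropositional.Properties ℕ._≟_ using (deduplicate-!)
open ≡-Reasoning

-- A partition is a multiset of pairs {i, i}, each of weight 2i, together with an independent set of
-- unpaired parts. The pairs whose largest size is k are counted by q^(2k) / (q²; q²)ₖ and carry the
-- sign (-1)ᵏ; this is the origin of F. The obstacle is that F, its infinite products and the limit
-- of F_j are infinite objects. Every series is therefore cut off by a bound m on the parts, and
-- identities are asserted only up to some degree. Multiplying the truncated F_j by (1 + q) ⋯ (1 +
-- qᵐ) turns its k-th term into (-1)ᵏ q^(2(j+1)k) times the series of partitions with parts at most
-- k, times the factors 1 + qⁱ for k < i ≤ m. Hence no inverse series occurs; only factors 1 + qᵏ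
-- with k > 0 have to be cancelled. The truncation costs one boundary term per step, whose degree
-- lies beyond the range of comparison.

private
  variable
    A B : Set

-- `F (n - k)` with default `d` when `n < k`. With `d = 0ℤ` it is multiplication by qᵏ; with
-- `d = []` it enumerates the objects of size `n - k`. One definition for both lets sums over lists
-- pass directly to series.
shift : {A : Set} → A → ℕ → (ℕ → A) → ℕ → A
shift d zero    F n       = F n
shift d (suc k) F zero    = d
shift d (suc k) F (suc n) = shift d k F n

-- The premise is asked only at the index `j` with `k + j ≡ n`. This keeps degree bounds available
-- in `q^-cong` and the descent `j < n` in `1+q^-cancel`.
shift-map : {A B : Set} {d : A} {e : B} {F : ℕ → A} {G : ℕ → B} (h : A → B) → h d ≡ e →
            ∀ k n → (∀ j → k ℕ.+ j ≡ n → h (F j) ≡ G j) → h (shift d k F n) ≡ shift e k G n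
shift-map h hd zero    n       hF = hF n refl
shift-map h hd (suc k) zero    hF = hd
shift-map h hd (suc k) (suc n) hF = shift-map h hd k n λ j eq → hF j (cong suc eq)

shift-shift : {A : Set} {d : A} {F : ℕ → A} → ∀ j k n →
              shift d j (shift d k F) n ≡ shift d (j ℕ.+ k) F n
shift-shift zero    k n       = refl
shift-shift (suc j) k zero    = refl
shift-shift (suc j) k (suc n) = shift-shift j k n

shift-< : {A : Set} {d : A} {F : ℕ → A} → ∀ k {n} → n ℕ.< k → shift d k F n ≡ d
shift-< (suc k) {zero}  _         = refl
shift-< (suc k) {suc n} (s≤s n<k) = shift-< k n<k

shift-preserves : ∀ (P : A → Set) {d F} → P d → (∀ j → P (F j)) → ∀ k n → P (shift d k F n)
shift-preserves P Pd PF zero    n       = PF n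
shift-preserves P Pd PF (suc k) zero    = Pd
shift-preserves P Pd PF (suc k) (suc n) = shift-preserves P Pd PF k n

∈-shift⁻ : ∀ {x : A} {F} k n → x ∈ shift [] k F n → ∃[ j ] k ℕ.+ j ≡ n × x ∈ F j
∈-shift⁻ zero    n       x∈ = n , refl , x∈
∈-shift⁻ (suc k) (suc n) x∈ with ∈-shift⁻ k n x∈
... | j , eq , x∈F = j , cong suc eq , x∈F

∈-shift⁺ : ∀ {x : A} {F} k {j n} → k ℕ.+ j ≡ n → x ∈ F j → x ∈ shift [] k F n
∈-shift⁺ zero    refl x∈ = x∈
∈-shift⁺ (suc k) refl x∈ = ∈-shift⁺ k refl x∈

-- Formal power series

Series : Set
Series = ℕ → ℤ

q^_·_ : ℕ → Series → Series
q^ k · f = shift 0ℤ k f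

infixr 8 q^_·_ 1+q^_·_

1+q^_·_ : ℕ → Series → Series
(1+q^ k · f) n = f n + (q^ k · f) n

infix 4 _≈[_]_

-- Congruence modulo q^(N+1), the substitute for limits of series.
_≈[_]_ : Series → ℕ → Series → Set
f ≈[ N ] g = ∀ n → n ℕ.≤ N → f n ≡ g n

q^-cong : ∀ {f g N} k → f ≈[ N ] g → q^ k · f ≈[ N ] q^ k · g
q^-cong k f≈g n n≤N = shift-map (λ z → z) refl k n λ j eq →
  f≈g j (ℕ.≤-trans (ℕ.m≤n+m j k) (ℕ.≤-trans (ℕ.≤-reflexive eq) n≤N))

q^-≗ : ∀ {f g} k → f ≗ g → q^ k · f ≗ q^ k · g
q^-≗ k f≗g n = shift-map (λ z → z) refl k n λ j _ → f≗g j

q^-+ : ∀ k {f g} → q^ k · (λ n → f n + g n) ≗ λ n → (q^ k · f) n + (q^ k · g) n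
q^-+ zero    n       = refl
q^-+ (suc k) zero    = refl
q^-+ (suc k) (suc n) = q^-+ k n

q^-* : ∀ k c {f} → q^ k · (λ n → c * f n) ≗ λ n → c * (q^ k · f) n
q^-* k c n = sym (shift-map (c *_) (*-zeroʳ c) k n λ _ _ → refl)

q^-comm : ∀ j k f → q^ j · q^ k · f ≗ q^ k · q^ j · f
q^-comm j k f n = begin
  (q^ j · q^ k · f) n  ≡⟨ shift-shift j k n ⟩
  (q^ j ℕ.+ k · f) n   ≡⟨ cong (λ i → (q^ i · f) n) (ℕ.+-comm j k) ⟩
  (q^ k ℕ.+ j · f) n   ≡⟨ shift-shift k j n ⟨
  (q^ k · q^ j · f) n  ∎

1+q^-cong : ∀ {f g N} k → f ≈[ N ] g → 1+q^ k · f ≈[ N ] 1+q^ k · g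
1+q^-cong k f≈g n n≤N = cong₂ _+_ (f≈g n n≤N) (q^-cong k f≈g n n≤N)

1+q^-≗ : ∀ {f g} k → f ≗ g → 1+q^ k · f ≗ 1+q^ k · g
1+q^-≗ k f≗g n = cong₂ _+_ (f≗g n) (q^-≗ k f≗g n)

1+q^-+ : ∀ k f g → 1+q^ k · (λ n → f n + g n) ≗ λ n → (1+q^ k · f) n + (1+q^ k · g) n
1+q^-+ k f g n = begin
  f n + g n + (q^ k · (λ n → f n + g n)) n      ≡⟨ cong (λ z → f n + g n + z) (q^-+ k n) ⟩
  f n + g n + ((q^ k · f) n + (q^ k · g) n)     ≡⟨ interchange (f n) (g n) _ _ ⟩
  f n + (q^ k · f) n + (g n + (q^ k · g) n)     ∎
  where
  interchange : ∀ a b c d → a + b + (c + d) ≡ a + c + (b + d)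
  interchange = solve-∀

1+q^-* : ∀ k c f → 1+q^ k · (λ n → c * f n) ≗ λ n → c * (1+q^ k · f) n
1+q^-* k c f n = trans (cong (λ z → c * f n + z) (q^-* k c n)) (sym (*-distribˡ-+ c (f n) _))

q^-1+q^-comm : ∀ j k f → q^ j · 1+q^ k · f ≗ 1+q^ k · q^ j · f
q^-1+q^-comm j k f n = trans (q^-+ j n) (cong (λ z → (q^ j · f) n + z) (q^-comm j k f n))

1+q^-comm : ∀ j k f → 1+q^ j · 1+q^ k · f ≗ 1+q^ k · 1+q^ j · f
1+q^-comm j k f n =
  trans (cong (λ z → (1+q^ k · f) n + z) (q^-1+q^-comm j k f n)) (sym (1+q^-+ k f (q^ j · f) n))

-- The coefficient at `n` is `f n` plus a coefficient of strictly smaller index, since the exponent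
-- is positive; strong induction equates the latter, and subtraction leaves `f n ≡ g n`.
1+q^-cancel : ∀ {f g N} k → 1+q^ suc k · f ≈[ N ] 1+q^ suc k · g → f ≈[ N ] g
1+q^-cancel {f} {g} {N} k eq = <-rec _ λ n rec n≤N →
  ∙-cancelʳ _ (f n) (g n) (trans (eq n n≤N) (cong (λ z → g n + z) (sym (agree n rec n≤N))))
  where
  agree : ∀ n → (∀ {j} → j ℕ.< n → j ℕ.≤ N → f j ≡ g j) → n ℕ.≤ N →
          (q^ suc k · f) n ≡ (q^ suc k · g) n
  agree n rec n≤N = shift-map (λ z → z) refl (suc k) n λ j eq →
    let j<n = ℕ.≤-trans (s≤s (ℕ.m≤n+m j k)) (ℕ.≤-reflexive eq) in
    rec j<n (ℕ.≤-trans (ℕ.<⇒≤ j<n) n≤N)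

-- Finite products of factors 1 + q^e

∏[1+q^_]^_·_ : (ℕ → ℕ) → ℕ → Series → Series
∏[1+q^ e ]^ zero  · f = f
∏[1+q^ e ]^ suc m · f = 1+q^ e m · ∏[1+q^ e ]^ m · f

infixr 8 ∏[1+q^_]^_·_

∏-1+q^-comm : ∀ e m k f → ∏[1+q^ e ]^ m · 1+q^ k · f ≗ 1+q^ k · ∏[1+q^ e ]^ m · f
∏-1+q^-comm e zero    k f n = refl
∏-1+q^-comm e (suc m) k f n =
  trans (1+q^-≗ (e m) (∏-1+q^-comm e m k f) n) (1+q^-comm (e m) k (∏[1+q^ e ]^ m · f) n)

even odd : ℕ → ℕ
even i = suc i ℕ.* 2
odd  i = suc (i ℕ.* 2)

∏-even-odd : ∀ m f → ∏[1+q^ suc ]^ (m ℕ.* 2) · f ≗ ∏[1+q^ even ]^ m · ∏[1+q^ odd ]^ m · f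
∏-even-odd zero    f n = refl
∏-even-odd (suc m) f = 1+q^-≗ (even m) λ n → begin
  (1+q^ odd m · ∏[1+q^ suc ]^ (m ℕ.* 2) · f) n             ≡⟨ 1+q^-≗ (odd m) (∏-even-odd m f) n ⟩
  (1+q^ odd m · ∏[1+q^ even ]^ m · ∏[1+q^ odd ]^ m · f) n  ≡⟨ ∏-1+q^-comm even m (odd m) _ n ⟨
  (∏[1+q^ even ]^ m · ∏[1+q^ odd ]^ suc m · f) n           ∎

∏-even-cancel : ∀ {f g N} m → ∏[1+q^ even ]^ m · f ≈[ N ] ∏[1+q^ even ]^ m · g → f ≈[ N ] g
∏-even-cancel zero    eq = eq
∏-even-cancel (suc m) eq = ∏-even-cancel m (1+q^-cancel _ eq)

-- The truncated alternating series

n+n≡n*2 : ∀ k → k ℕ.+ k ≡ k ℕ.* 2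
n+n≡n*2 k = trans (cong (k ℕ.+_) (sym (ℕ.+-identityʳ k))) (ℕ.*-comm 2 k)

module Euler (p : ℕ → Series)
             (p-suc : ∀ m n → p (suc m) n ≡ p m n + (q^ suc m · p (suc m)) n) where

  -- Unfolding the recurrence twice gives (1 - q^(2(m+1))) p (m+1) = (1 + q^(m+1)) p m, written
  -- without subtraction. This is how the base q² enters.
  p-suc-suc : ∀ m n → p (suc m) n ≡ (1+q^ suc m · p m) n + (q^ even m · p (suc m)) n
  p-suc-suc m n = begin
    p (suc m) n
      ≡⟨ p-suc m n ⟩
    p m n + (q^ suc m · p (suc m)) n
      ≡⟨ cong (λ z → p m n + z) (trans (q^-≗ (suc m) (p-suc m) n) (q^-+ (suc m) n)) ⟩
    p m n + ((q^ suc m · p m) n + (q^ suc m · q^ suc m · p (suc m)) n)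
      ≡⟨ cong (λ z → p m n + ((q^ suc m · p m) n + z)) (trans (shift-shift (suc m) (suc m) n)
           (cong (λ i → (q^ i · p (suc m)) n) (n+n≡n*2 (suc m)))) ⟩
    p m n + ((q^ suc m · p m) n + (q^ even m · p (suc m)) n)
      ≡⟨ +-assoc (p m n) _ _ ⟨
    (1+q^ suc m · p m) n + (q^ even m · p (suc m)) n
      ∎

  -- If p 0 = 1, then in q-Pochhammer notation p m = 1 / (q; q)ₘ and
  -- G j m = (-q; q)ₘ Σ_{k ≤ m} (-1)ᵏ q^(2 (j + 1) k) / (q²; q²)ₖ.
  G : ℕ → ℕ → Series
  G j zero      = p 0
  G j (suc m) n = (1+q^ suc m · G j m) n + -1ℤ ^ suc m * (q^ (suc m ℕ.* even j) · p (suc m)) n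

  -- The finite form of (1 + q^(2(j+1))) F_j = F_{j+1}. The difference of the two sums telescopes
  -- term by term, and the last term, having no successor in the truncated sum, remains as the
  -- boundary term.
  G-suc : ∀ j m n → G (suc j) m n ≡
          (1+q^ even j · G j m) n + -1ℤ ^ suc m * (q^ (suc m ℕ.* even j) · p m) n
  G-suc j zero n = begin
    p 0 n
      ≡⟨ cancel (p 0 n) ((q^ even j · p 0) n) ⟩
    p 0 n + (q^ even j · p 0) n + -1ℤ * (q^ even j · p 0) n
      ≡⟨ cong (λ i → p 0 n + (q^ even j · p 0) n + -1ℤ * (q^ i · p 0) n) (sym (ℕ.+-identityʳ (even j))) ⟩
    p 0 n + (q^ even j · p 0) n + -1ℤ * (q^ (1 ℕ.* even j) · p 0) n
      ∎
    where
    cancel : ∀ a b → a ≡ a + b + -1ℤ * b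
    cancel = solve-∀
  G-suc j (suc m) n = begin
    (1+q^ M · G (suc j) m) n + σ * (q^ (M ℕ.* even (suc j)) · p M) n
      ≡⟨ cong₂ (λ a b → a + σ * b) left (trans (cong (λ i → (q^ i · p M) n) exponent)
           (sym (shift-shift e (even m) n))) ⟩
    Q + σ * P + σ * R
      ≡⟨ collect Q σ P R ⟩
    Q + σ * (P + R)
      -- The boundary term for `m` and the new summand of `G (suc j) M` are the two halves of
      -- `p-suc-suc`, shifted by `e`; they merge into one copy of `p M`.
      ≡⟨ cong (λ z → Q + σ * z) (sym (trans (q^-≗ e (p-suc-suc m) n)
           (trans (q^-+ e n) (cong (_+ R) (q^-1+q^-comm e M (p m) n))))) ⟩
    Q + σ * PM
      -- Adding `PM′` completes the factor `1+q^ even j` on the last summand of `G j M`; subtracting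
      -- it again is the boundary term for `M`.
      ≡⟨ cancel Q σ PM PM′ ⟩
    Q + σ * (PM + PM′) + -1ℤ * σ * PM′
      ≡⟨ cong₂ (λ a b → a + -1ℤ * σ * b) (sym right) (shift-shift (even j) e n) ⟩
    (1+q^ even j · G j M) n + -1ℤ * σ * (q^ (suc M ℕ.* even j) · p M) n
      ∎
    where
    M = suc m
    e = M ℕ.* even j
    σ = -1ℤ ^ M
    Q = (1+q^ M · 1+q^ even j · G j m) n
    P = (1+q^ M · q^ e · p m) n
    R = (q^ e · q^ even m · p M) n
    PM = (q^ e · p M) n
    PM′ = (q^ even j · q^ e · p M) n
    left : (1+q^ M · G (suc j) m) n ≡ Q + σ * P
    left = trans (1+q^-≗ M (G-suc j m) n)
      (trans (1+q^-+ M (1+q^ even j · G j m) (λ n → σ * (q^ e · p m) n) n)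
        (cong (λ z → Q + z) (1+q^-* M σ (q^ e · p m) n)))
    right : (1+q^ even j · G j M) n ≡ Q + σ * (PM + PM′)
    right = trans (1+q^-+ (even j) (1+q^ M · G j m) (λ n → σ * (q^ e · p M) n) n)
      (cong₂ _+_ (1+q^-comm (even j) M (G j m) n) (1+q^-* (even j) σ (q^ e · p M) n))
    exponent : M ℕ.* even (suc j) ≡ e ℕ.+ even m
    exponent = trans (ℕ.*-distribˡ-+ M 2 (even j)) (ℕ.+-comm (even m) e)
    collect : ∀ a s b c → a + s * b + s * c ≡ a + s * (b + c)
    collect = solve-∀
    cancel : ∀ a s b c → a + s * b ≡ a + s * (b + c) + -1ℤ * s * c
    cancel = solve-∀

  drop-shift : ∀ {k n} a c f → n ℕ.< k → a + c * (q^ k · f) n ≡ a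
  drop-shift {k} a c f n<k = trans (cong (λ z → a + c * z) (shift-< k n<k))
    (trans (cong (λ z → a + z) (*-zeroʳ c)) (+-identityʳ a))

  -- Every boundary term of `G-suc` starts in degree (m+1) · 2(j+1), which exceeds `m`.
  G≈∏even : ∀ j m → G j m ≈[ m ] ∏[1+q^ even ]^ j · G 0 m
  G≈∏even zero    m n n≤m = refl
  G≈∏even (suc j) m n n≤m =
    trans (G-suc j m n)
      (trans (drop-shift _ (-1ℤ ^ suc m) (p m) (ℕ.≤-trans (s≤s n≤m) (ℕ.m≤m*n (suc m) (even j))))
        (1+q^-cong (even j) (G≈∏even j m) n n≤m))

  -- The truncated form of F_j → 1: the summands with k ≥ 1 start in degree at least 2(j+1), so up
  -- to degree 2j only the term k = 0 with its factors 1 + qⁱ survives.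
  G≈∏suc : ∀ j m → G j m ≈[ j ℕ.* 2 ] ∏[1+q^ suc ]^ m · p 0
  G≈∏suc j zero    n n≤N = refl
  G≈∏suc j (suc m) n n≤N =
    trans (drop-shift _ (-1ℤ ^ suc m) (p (suc m))
            (ℕ.<-≤-trans (ℕ.≤-<-trans n≤N (ℕ.n<1+n _))
              (ℕ.≤-trans (ℕ.n≤1+n _) (ℕ.m≤n*m (even j) (suc m)))))
      (1+q^-cong (suc m) (G≈∏suc j m) n n≤N)

  -- `G m (m * 2)` is evaluated in two ways. The bound `m * 2` on the parts makes the 2m factors 1 +
  -- qⁱ split into exactly m even and m odd ones, and the even ones cancel.
  G₀≈∏odd : ∀ m → G 0 (m ℕ.* 2) ≈[ m ℕ.* 2 ] ∏[1+q^ odd ]^ m · p 0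
  G₀≈∏odd m = ∏-even-cancel m λ n n≤ → begin
    (∏[1+q^ even ]^ m · G 0 (m ℕ.* 2)) n                ≡⟨ G≈∏even m (m ℕ.* 2) n n≤ ⟨
    G m (m ℕ.* 2) n                                     ≡⟨ G≈∏suc m (m ℕ.* 2) n n≤ ⟩
    (∏[1+q^ suc ]^ (m ℕ.* 2) · p 0) n                   ≡⟨ ∏-even-odd m (p 0) n ⟩
    (∏[1+q^ even ]^ m · ∏[1+q^ odd ]^ m · p 0) n        ∎

-- Signed sums over partitions

∑ : (A → ℤ) → List A → ℤ
∑ f []       = 0ℤ
∑ f (x ∷ xs) = f x + ∑ f xs

∑-++ : ∀ (f : A → ℤ) xs ys → ∑ f (xs ++ ys) ≡ ∑ f xs + ∑ f ys
∑-++ f []       ys = sym (+-identityˡ _)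
∑-++ f (x ∷ xs) ys = trans (cong (λ z → f x + z) (∑-++ f xs ys)) (sym (+-assoc (f x) _ _))

∑-map : ∀ (f : B → ℤ) (h : A → B) xs → ∑ f (map h xs) ≡ ∑ (f ∘ h) xs
∑-map f h []       = refl
∑-map f h (x ∷ xs) = cong (λ z → f (h x) + z) (∑-map f h xs)

∑-cong-local : ∀ {f g : A → ℤ} {xs} → (∀ {x} → x ∈ xs → f x ≡ g x) → ∑ f xs ≡ ∑ g xs
∑-cong-local {xs = []}     f≡g = refl
∑-cong-local {xs = x ∷ xs} f≡g = cong₂ _+_ (f≡g (here refl)) (∑-cong-local (f≡g ∘ there))

∑-* : ∀ c (f : A → ℤ) xs → ∑ (λ x → c * f x) xs ≡ c * ∑ f xs
∑-* c f []       = sym (*-zeroʳ c)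
∑-* c f (x ∷ xs) = trans (cong (λ z → c * f x + z) (∑-* c f xs)) (sym (*-distribˡ-+ c (f x) _))

∑-1 : ∀ (xs : List A) → ∑ (const 1ℤ) xs ≡ + length xs
∑-1 []       = refl
∑-1 (x ∷ xs) = cong (λ z → 1ℤ + z) (∑-1 xs)

∑-↭ : ∀ (f : A → ℤ) {xs ys} → xs ↭ ys → ∑ f xs ≡ ∑ f ys
∑-↭ f ↭.refl             = refl
∑-↭ f (↭.prep x xs↭ys)   = cong (λ z → f x + z) (∑-↭ f xs↭ys)
∑-↭ f (↭.swap x y xs↭ys) = trans (cong (λ z → f x + (f y + z)) (∑-↭ f xs↭ys)) (exchange (f x) (f y) _)
  where
  exchange : ∀ a b c → a + (b + c) ≡ b + (a + c)
  exchange = solve-∀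
∑-↭ f (↭.trans p q)      = trans (∑-↭ f p) (∑-↭ f q)

∑-shift : ∀ (f : A → ℤ) F k → (λ n → ∑ f (shift [] k F n)) ≗ q^ k · (λ n → ∑ f (F n))
∑-shift f F k n = shift-map (∑ f) refl k n λ _ _ → refl

-- Decompositions of lists of partitions are proved through this: only membership and absence of
-- repetition matter, not the order of enumeration.
unique-↭ : ∀ {xs ys : List A} → Unique xs → Unique ys →
           (∀ {x} → x ∈ xs → x ∈ ys) → (∀ {x} → x ∈ ys → x ∈ xs) → xs ↭ ys
unique-↭ xs! ys! xs⊆ys ys⊆xs = ∼bag⇒↭ (unique∧set⇒bag xs! ys! (mk⇔ xs⊆ys ys⊆xs))

-- Partitions with bounded parts

boundedPartitions : ℕ → ℕ → List (List ℕ)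
boundedPartitions m n = filter (All.all? (ℕ._≤? m)) (partitions n)

∈-bounded⁻ : ∀ {m n ps} → ps ∈ boundedPartitions m n → IsPartition n ps × All (_≤ m) ps
∈-bounded⁻ {m} {n} ps∈ with ∈-filter⁻ (All.all? (ℕ._≤? m)) {xs = partitions n} ps∈
... | ps∈′ , ps≤m = Equivalence.to ∈-partitions ps∈′ , ps≤m

∈-bounded⁺ : ∀ {m n ps} → IsPartition n ps → All (_≤ m) ps → ps ∈ boundedPartitions m n
∈-bounded⁺ {m} isP = ∈-filter⁺ (All.all? (ℕ._≤? m)) (Equivalence.from ∈-partitions isP)

bounded-unique : ∀ m n → Unique (boundedPartitions m n)
bounded-unique m n = Unique.filter⁺ (All.all? (ℕ._≤? m)) (partitions-unique n)

bounded-≥ : ∀ {m n} → n ≤ m → boundedPartitions m n ≡ partitions n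
bounded-≥ {m} {n} n≤m = filter-all (All.all? (ℕ._≤? m)) (All.tabulate parts≤m)
  where
  parts≤m : ∀ {ps} → ps ∈ partitions n → All (_≤ m) ps
  parts≤m ps∈ with Equivalence.to (∈-partitions {n}) ps∈
  ... | _ , _ , refl = All.map (λ p≤ → ℕ.≤-trans p≤ n≤m) (parts≤sum _)

head≥ : ∀ {x xs} → Linked _≥_ (x ∷ xs) → All (_≤ x) xs
head≥ = All.tail ∘ Linked.Linked⇒All (λ x≥y y≥z → ℕ.≤-trans y≥z x≥y) ℕ.≤-refl

Linked-∷ : ∀ {x xs} → All (_≤ x) xs → Linked _≥_ xs → Linked _≥_ (x ∷ xs)
Linked-∷ []      []      = [-]
Linked-∷ (p ∷ _) [-]     = p ∷ [-]
Linked-∷ (p ∷ _) (q ∷ l) = p ∷ q ∷ l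

-- Either the part `suc m` is absent or one copy can be removed from the front. The rest keeps the
-- bound `suc m`, because the part may be repeated.
bounded-suc : ∀ m n → boundedPartitions (suc m) n ↭
              boundedPartitions m n ++ map (suc m ∷_) (shift [] (suc m) (boundedPartitions (suc m)) n)
bounded-suc m n = unique-↭ (bounded-unique (suc m) n)
  (Unique.++⁺ (bounded-unique m n)
    (Unique.map⁺ ∷-injectiveʳ (shift-preserves Unique [] (bounded-unique (suc m)) (suc m) n)) disjoint)
  split join
  where
  disjoint : ∀ {ps} → ¬ (ps ∈ boundedPartitions m n ×
             ps ∈ map (suc m ∷_) (shift [] (suc m) (boundedPartitions (suc m)) n))
  disjoint (ps∈ , ps∈′) with ∈-map⁻ (suc m ∷_) ps∈′
  ... | _ , _ , refl = ℕ.1+n≰n (All.head (proj₂ (∈-bounded⁻ {m} {n} ps∈)))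
  split : ∀ {ps} → ps ∈ boundedPartitions (suc m) n → ps ∈ boundedPartitions m n ++ _
  split {[]}     ps∈ = ∈-++⁺ˡ (∈-bounded⁺ (proj₁ (∈-bounded⁻ {suc m} {n} ps∈)) [])
  split {x ∷ xs} ps∈ with ∈-bounded⁻ {suc m} {n} ps∈
  ... | isP@(l , (_ ∷ pos) , eq) , x≤ ∷ xs≤ with x ℕ.≟ suc m
  ...   | yes refl = ∈-++⁺ʳ (boundedPartitions m n) (∈-map⁺ (suc m ∷_)
                       (∈-shift⁺ (suc m) eq (∈-bounded⁺ (Linked.tail l , pos , refl) xs≤)))
  ...   | no x≢    = let x≤m = ℕ.≤-pred (ℕ.≤∧≢⇒< x≤ x≢) in
                     ∈-++⁺ˡ (∈-bounded⁺ isP (x≤m ∷ All.map (λ y≤x → ℕ.≤-trans y≤x x≤m) (head≥ l)))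
  join : ∀ {ps} → ps ∈ boundedPartitions m n ++ _ → ps ∈ boundedPartitions (suc m) n
  join ps∈ with ∈-++⁻ (boundedPartitions m n) ps∈
  ... | inj₁ ps∈ˡ = let isP , ps≤m = ∈-bounded⁻ {m} {n} ps∈ˡ in ∈-bounded⁺ isP (All.map ℕ.m≤n⇒m≤1+n ps≤m)
  ... | inj₂ ps∈ʳ with ∈-map⁻ (suc m ∷_) ps∈ʳ
  ...   | xs , xs∈ , refl with ∈-shift⁻ (suc m) n xs∈
  ...     | j , eq , xs∈′ with ∈-bounded⁻ {suc m} {j} xs∈′
  ...       | (l , pos , refl) , xs≤ =
    ∈-bounded⁺ (Linked-∷ xs≤ l , s≤s z≤n ∷ pos , eq) (ℕ.≤-refl ∷ xs≤)

∑-bounded-suc : ∀ f m n → ∑ f (boundedPartitions (suc m) n) ≡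
  ∑ f (boundedPartitions m n) + (q^ suc m · (λ j → ∑ (f ∘ (suc m ∷_)) (boundedPartitions (suc m) j))) n
∑-bounded-suc f m n = begin
  ∑ f (boundedPartitions (suc m) n)
    ≡⟨ ∑-↭ f (bounded-suc m n) ⟩
  ∑ f (boundedPartitions m n ++ map (suc m ∷_) rest)
    ≡⟨ ∑-++ f (boundedPartitions m n) _ ⟩
  ∑ f (boundedPartitions m n) + ∑ f (map (suc m ∷_) rest)
    ≡⟨ cong (λ z → ∑ f (boundedPartitions m n) + z)
         (trans (∑-map f (suc m ∷_) rest) (∑-shift (f ∘ (suc m ∷_)) (boundedPartitions (suc m)) (suc m) n)) ⟩
  _ ∎
  where
  rest = shift [] (suc m) (boundedPartitions (suc m)) n

-- Multiplicities and the largest paired part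

multiplicity-≢ : ∀ {k x} ps → k ≢ x → multiplicity k (x ∷ ps) ≡ multiplicity k ps
multiplicity-≢ {k} ps k≢x = cong length (filter-reject (k ℕ.≟_) k≢x)

multiplicity-≡ : ∀ k ps → multiplicity k (k ∷ ps) ≡ suc (multiplicity k ps)
multiplicity-≡ k ps = cong length (filter-accept (k ℕ.≟_) refl)

multiplicity-∉ : ∀ {k ps} → All (k ≢_) ps → multiplicity k ps ≡ 0
multiplicity-∉ {k} k∉ = cong length (filter-none (k ℕ.≟_) k∉)

filter-cong-local : ∀ {P Q : Pred A 0ℓ} (P? : Decidable P) (Q? : Decidable Q) {xs} →
                    All (λ x → (P x → Q x) × (Q x → P x)) xs → filter P? xs ≡ filter Q? xs
filter-cong-local P? Q? []                              = refl
filter-cong-local P? Q? {x ∷ xs} ((P⇒Q , Q⇒P) ∷ rest) with P? x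
... | yes Px = trans (cong (x ∷_) (filter-cong-local P? Q? rest)) (sym (filter-accept Q? (P⇒Q Px)))
... | no ¬Px = trans (filter-cong-local P? Q? rest) (sym (filter-reject Q? (¬Px ∘ Q⇒P)))

repeated? : ∀ ps → Decidable (λ k → 2 ≤ multiplicity k ps)
repeated? ps k = 2 ℕ.≤? multiplicity k ps

r-∷ : ∀ {m ps} → All (_< m) ps → r (m ∷ ps) ≡ r ps
r-∷ {m} {ps} ps<m = cong (max 0) (trans
  (filter-reject (repeated? (m ∷ ps)) {x = m} {xs = ps} single)
  (filter-cong-local (repeated? (m ∷ ps)) (repeated? ps) (All.map same ps<m)))
  where
  single : ¬ 2 ≤ multiplicity m (m ∷ ps)
  single 2≤ = ℕ.1+n≰n (subst (2 ≤_) (trans (multiplicity-≡ m ps)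
    (cong suc (multiplicity-∉ (All.map (λ x<m m≡x → ℕ.<⇒≢ x<m (sym m≡x)) ps<m)))) 2≤)
  same : ∀ {k} → k < m → (2 ≤ multiplicity k (m ∷ ps) → 2 ≤ multiplicity k ps) ×
                         (2 ≤ multiplicity k ps → 2 ≤ multiplicity k (m ∷ ps))
  same k<m = let eq = multiplicity-≢ ps (ℕ.<⇒≢ k<m) in subst (2 ≤_) eq , subst (2 ≤_) (sym eq)

r-∷-∷ : ∀ {m ps} → All (_≤ m) ps → r (m ∷ m ∷ ps) ≡ m
r-∷-∷ {m} {ps} ps≤m = max≈v⁺ (∈-filter⁺ (repeated? (m ∷ m ∷ ps)) (here refl) pair)
  (All.tabulate (λ k∈ → All.lookup (ℕ.≤-refl ∷ ℕ.≤-refl ∷ ps≤m)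
    (proj₁ (∈-filter⁻ (repeated? (m ∷ m ∷ ps)) {xs = m ∷ m ∷ ps} k∈)))) z≤n
  where
  pair : 2 ≤ multiplicity m (m ∷ m ∷ ps)
  pair = subst (2 ≤_) (sym (trans (multiplicity-≡ m (m ∷ ps)) (cong suc (multiplicity-≡ m ps)))) (s≤s (s≤s z≤n))

-- Generating function of the sign (-1)^r

partitionSeries : ℕ → Series
partitionSeries m n = ∑ (const 1ℤ) (boundedPartitions m n)

pairSign : List ℕ → ℤ
pairSign ps = -1ℤ ^ r ps

pairSignSeries : ℕ → Series
pairSignSeries m n = ∑ pairSign (boundedPartitions m n)

open Euler partitionSeries (∑-bounded-suc (const 1ℤ))

-- Sort by the multiplicity of the part M = m+1. If it is 0 or 1, the sign is that of the smaller
-- parts, giving the factor 1 + q^M; if it is at least 2, then r = M whatever the rest is, giving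
-- (-1)^M q^(2M) times all partitions with parts at most M.
pairSignSeries-suc : ∀ m n → pairSignSeries (suc m) n ≡
  (1+q^ suc m · pairSignSeries m) n + -1ℤ ^ suc m * (q^ (suc m ℕ.* 2) · partitionSeries (suc m)) n
pairSignSeries-suc m n = begin
  pairSignSeries M n
    ≡⟨ ∑-bounded-suc pairSign m n ⟩
  a n + (q^ M · (λ j → ∑ (pairSign ∘ (M ∷_)) (boundedPartitions M j))) n
    ≡⟨ cong (λ z → a n + z) (trans (q^-≗ M once n) (q^-+ M n)) ⟩
  a n + ((q^ M · a) n + (q^ M · (λ j → σ * (q^ M · partitionSeries M) j)) n)
    ≡⟨ +-assoc (a n) _ _ ⟨
  (1+q^ M · a) n + (q^ M · (λ j → σ * (q^ M · partitionSeries M) j)) n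
    ≡⟨ cong (λ z → (1+q^ M · a) n + z) (trans (q^-* M σ n) (cong (σ *_) (trans (shift-shift M M n)
         (cong (λ i → (q^ i · partitionSeries M) n) (n+n≡n*2 M))))) ⟩
  (1+q^ M · a) n + σ * (q^ (M ℕ.* 2) · partitionSeries M) n
    ∎
  where
  M = suc m
  σ = -1ℤ ^ M
  a = pairSignSeries m
  twice : ∀ j → ∑ (pairSign ∘ (M ∷_) ∘ (M ∷_)) (boundedPartitions M j) ≡ σ * partitionSeries M j
  twice j = trans
    (∑-cong-local λ ps∈ → trans (cong (-1ℤ ^_) (r-∷-∷ (proj₂ (∈-bounded⁻ {M} {j} ps∈)))) (sym (*-identityʳ σ)))
    (∑-* σ (const 1ℤ) (boundedPartitions M j))
  once : ∀ j → ∑ (pairSign ∘ (M ∷_)) (boundedPartitions M j) ≡ a j + σ * (q^ M · partitionSeries M) j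
  once j = trans (∑-bounded-suc (pairSign ∘ (M ∷_)) m j) (cong₂ _+_
    (∑-cong-local λ ps∈ → cong (-1ℤ ^_) (r-∷ (All.map s≤s (proj₂ (∈-bounded⁻ {m} {j} ps∈)))))
    (trans (q^-≗ M twice j) (q^-* M σ j)))

pairSignSeries≗G : ∀ m → pairSignSeries m ≗ G 0 m
pairSignSeries≗G zero    n = ∑-cong-local {g = const 1ℤ} λ {ps} ps∈ → cong (-1ℤ ^_) (r-zero ps∈)
  where
  r-zero : ∀ {ps} → ps ∈ boundedPartitions 0 n → r ps ≡ 0
  r-zero {ps} ps∈ with ps | ∈-bounded⁻ {0} {n} ps∈
  ... | []    | _ = refl
  ... | x ∷ _ | (_ , 0<x ∷ _ , _) , x≤0 ∷ _ = ⊥-elim (ℕ.<⇒≱ 0<x x≤0)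
pairSignSeries≗G (suc m) n = trans (pairSignSeries-suc m n)
  (cong (λ z → z + -1ℤ ^ suc m * (q^ (suc m ℕ.* 2) · partitionSeries (suc m)) n) (1+q^-≗ (suc m) (pairSignSeries≗G m) n))

-- Parity of the rank

-- The sum of k times the multiplicity of k over all k < `N`. It recovers the size of a partition
-- from its multiplicities, so that parities of multiplicities give the parity of the size.
weightedMultiplicity : ℕ → List ℕ → ℕ
weightedMultiplicity zero    ps = 0
weightedMultiplicity (suc N) ps = weightedMultiplicity N ps ℕ.+ N ℕ.* multiplicity N ps

weightedMultiplicity-≤ : ∀ {N x} ps → N ≤ x → weightedMultiplicity N (x ∷ ps) ≡ weightedMultiplicity N ps
weightedMultiplicity-≤ {zero}  ps _   = refl
weightedMultiplicity-≤ {suc N} ps N<x = cong₂ (λ a b → a ℕ.+ N ℕ.* b)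
  (weightedMultiplicity-≤ ps (ℕ.<⇒≤ N<x)) (multiplicity-≢ ps (ℕ.<⇒≢ N<x))

weightedMultiplicity-< : ∀ {N x} ps → x < N →
  weightedMultiplicity N (x ∷ ps) ≡ x ℕ.+ weightedMultiplicity N ps
weightedMultiplicity-< {suc N} {x} ps x<1+N with x ℕ.≟ N
... | yes refl = begin
  weightedMultiplicity x (x ∷ ps) ℕ.+ x ℕ.* multiplicity x (x ∷ ps)
    ≡⟨ cong₂ (λ a b → a ℕ.+ x ℕ.* b) (weightedMultiplicity-≤ {x} ps ℕ.≤-refl) (multiplicity-≡ x ps) ⟩
  w ℕ.+ x ℕ.* suc (multiplicity x ps)
    ≡⟨ cong (w ℕ.+_) (ℕ.*-suc x _) ⟩
  w ℕ.+ (x ℕ.+ x ℕ.* multiplicity x ps)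
    ≡⟨ +.x∙yz≈y∙xz w x _ ⟩
  x ℕ.+ (w ℕ.+ x ℕ.* multiplicity x ps)
    ∎
  where
  w = weightedMultiplicity x ps
... | no x≢N = trans
  (cong₂ (λ a b → a ℕ.+ N ℕ.* b)
    (weightedMultiplicity-< ps (ℕ.≤∧≢⇒< (ℕ.≤-pred x<1+N) x≢N)) (multiplicity-≢ ps (x≢N ∘ sym)))
  (ℕ.+-assoc x _ _)

weightedMultiplicity-sum : ∀ {N ps} → All (_< N) ps → weightedMultiplicity N ps ≡ sum ps
weightedMultiplicity-sum {zero}  []                  = refl
weightedMultiplicity-sum {suc N} []                  = trans
  (cong₂ ℕ._+_ (weightedMultiplicity-sum {N} []) (ℕ.*-zeroʳ N)) refl
weightedMultiplicity-sum {N} {p ∷ ps} (p<N ∷ ps<N) = trans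
  (weightedMultiplicity-< ps p<N) (cong (p ℕ.+_) (weightedMultiplicity-sum ps<N))

weightedMultiplicity-even : ∀ {ps qs} → (∀ k → 2 ℕ.∣ multiplicity k ps ℕ.+ multiplicity k qs) →
  ∀ N → 2 ℕ.∣ weightedMultiplicity N ps ℕ.+ weightedMultiplicity N qs
weightedMultiplicity-even even-mult zero    = 2 ℕ.∣0
weightedMultiplicity-even {ps} {qs} even-mult (suc N) = subst (2 ℕ.∣_)
  (trans (cong (w ps ℕ.+ w qs ℕ.+_) (ℕ.*-distribˡ-+ N _ _)) (+.interchange (w ps) (w qs) _ _))
  (ℕ.∣m∣n⇒∣m+n (weightedMultiplicity-even {ps} {qs} even-mult N) (ℕ.∣n⇒∣m*n N (even-mult N)))
  where
  w = weightedMultiplicity N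

sum-even : ∀ {ps qs} → (∀ k → 2 ℕ.∣ multiplicity k ps ℕ.+ multiplicity k qs) → 2 ℕ.∣ sum ps ℕ.+ sum qs
sum-even {ps} {qs} even-mult = subst (2 ℕ.∣_)
  (cong₂ ℕ._+_
    (weightedMultiplicity-sum (All.map (λ p≤ → s≤s (ℕ.≤-trans p≤ (ℕ.m≤m+n (sum ps) (sum qs)))) (parts≤sum ps)))
    (weightedMultiplicity-sum (All.map (λ q≤ → s≤s (ℕ.≤-trans q≤ (ℕ.m≤n+m (sum qs) (sum ps)))) (parts≤sum qs))))
  (weightedMultiplicity-even {ps} {qs} even-mult (suc (sum ps ℕ.+ sum qs)))

multiplicity-∈ : ∀ {k ps} → Unique ps → k ∈ ps → multiplicity k ps ≡ 1
multiplicity-∈ {k} {_ ∷ ps} (k∉ ∷ _)   (here refl) =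
  trans (multiplicity-≡ k ps) (cong suc (multiplicity-∉ k∉))
multiplicity-∈ {k} {_ ∷ ps} (p∉ ∷ ps!) (there k∈)  =
  trans (multiplicity-≢ ps (All.lookup p∉ k∈ ∘ sym)) (multiplicity-∈ ps! k∈)

odd⇒even-suc : ∀ m → ¬ 2 ℕ.∣ m → 2 ℕ.∣ suc m
odd⇒even-suc zero          odd = ⊥-elim (odd (2 ℕ.∣0))
odd⇒even-suc (suc zero)    odd = ℕ.∣-refl
odd⇒even-suc (suc (suc m)) odd = ℕ.∣m∣n⇒∣m+n (ℕ.∣-refl {2}) (odd⇒even-suc m (odd ∘ ℕ.∣m∣n⇒∣m+n (ℕ.∣-refl {2})))

oddMultiplicity? : ∀ ps → Decidable (λ k → ¬ 2 ℕ.∣ multiplicity k ps)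
oddMultiplicity? ps k = ¬? (2 ℕ.∣? multiplicity k ps)

∈-unpaired⁻ : ∀ {k} ps → k ∈ unpaired ps → ¬ 2 ℕ.∣ multiplicity k ps
∈-unpaired⁻ ps = proj₂ ∘ ∈-filter⁻ (oddMultiplicity? ps) {xs = ps} ∘ ∈-deduplicate⁻ ℕ._≟_ _

∈-unpaired⁺ : ∀ {k} ps → k ∈ ps → ¬ 2 ℕ.∣ multiplicity k ps → k ∈ unpaired ps
∈-unpaired⁺ ps k∈ odd = ∈-deduplicate⁺ ℕ._≟_ (∈-filter⁺ (oddMultiplicity? ps) k∈ odd)

∉⇒multiplicity : ∀ {k ps} → k ∉ ps → multiplicity k ps ≡ 0
∉⇒multiplicity k∉ = multiplicity-∉ (All.¬Any⇒All¬ _ k∉)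

-- An entry occurs in `unpaired ps` once or not at all, according to the parity of its multiplicity
-- in `ps`.
multiplicity-unpaired : ∀ ps k → 2 ℕ.∣ multiplicity k (unpaired ps) ℕ.+ multiplicity k ps
multiplicity-unpaired ps k with 2 ℕ.∣? multiplicity k ps
... | yes even = subst (λ i → 2 ℕ.∣ i ℕ.+ multiplicity k ps)
  (sym (∉⇒multiplicity λ k∈ → ∈-unpaired⁻ ps k∈ even)) even
... | no odd with k ∈? ps
...   | yes k∈ = subst (λ i → 2 ℕ.∣ i ℕ.+ multiplicity k ps)
  (sym (multiplicity-∈ (deduplicate-! (filter (oddMultiplicity? ps) ps)) (∈-unpaired⁺ ps k∈ odd)))
  (odd⇒even-suc _ odd)
...   | no k∉  = ⊥-elim (odd (subst (2 ℕ.∣_) (sym (∉⇒multiplicity k∉)) (2 ℕ.∣0)))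

-- Signs are invisible modulo 2; each step of the recursion contributes twice the remaining
-- alternating sum.
sum-alternatingSum : ∀ us → + 2 ∣ + sum us - alternatingSum us
sum-alternatingSum []       = divides 0ℤ refl
sum-alternatingSum (u ∷ us) = subst (+ 2 ∣_)
  (trans (regroup (+ u) (+ sum us) (alternatingSum us)) (cong (_- (+ u - alternatingSum us)) (sym (pos-+ u (sum us)))))
  (∣m∣n⇒∣m+n (sum-alternatingSum us) (divides (alternatingSum us) refl))
  where
  regroup : ∀ a b c → b - c + c * + 2 ≡ a + b - (a - c)
  regroup = solve-∀

-- The difference is |λ| + s(λ). The unpaired parts link the two terms: their sum has the parity of
-- |λ| by the multiplicities, and that of s(λ) by `sum-alternatingSum`.
r+sum-pairingRank : ∀ ps → + 2 ∣ + (r ps ℕ.+ sum ps) - pairingRank ps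
r+sum-pairingRank ps = subst (+ 2 ∣_)
  (trans (cong (_- (+ sum us - s ps)) (pos-+ (sum us) (sum ps)))
    (trans (regroup (+ r ps) (+ sum us) (+ sum ps) (s ps)) (cong (_- pairingRank ps) (sym (pos-+ (r ps) (sum ps))))))
  (∣m∣n⇒∣m-n (∣ᵤ⇒∣ {+ 2} {+ (sum us ℕ.+ sum ps)} (sum-even {us} {ps} (multiplicity-unpaired ps)))
    (sum-alternatingSum us))
  where
  us = unpaired ps
  regroup : ∀ a b c d → b + c - (b - d) ≡ a + c - (a - d)
  regroup = solve-∀

-- From parities to signs

-1^even : ∀ m → 2 ℕ.∣ m → -1ℤ ^ m ≡ 1ℤ
-1^even m (ℕ.divides-refl q) = begin
  -1ℤ ^ (q ℕ.* 2)  ≡⟨ cong (-1ℤ ^_) (ℕ.*-comm q 2) ⟩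
  -1ℤ ^ (2 ℕ.* q)  ≡⟨ ^-*-assoc -1ℤ 2 q ⟨
  1ℤ ^ q           ≡⟨ ^-zeroˡ q ⟩
  1ℤ               ∎

-1^odd : ∀ m → ¬ 2 ℕ.∣ m → -1ℤ ^ m ≡ -1ℤ
-1^odd m odd = begin
  -1ℤ ^ m                ≡⟨ neg-involutive _ ⟨
  - - (-1ℤ ^ m)          ≡⟨ cong -_ (-1*i≡-i _) ⟨
  - (-1ℤ ^ suc m)        ≡⟨ cong -_ (-1^even (suc m) (odd⇒even-suc m odd)) ⟩
  -1ℤ                    ∎

decSign : ∀ {P : Set} → Dec P → ℤ
decSign P? = if does P? then 1ℤ else -1ℤ

decSign-elim : ∀ {P : Set} (P? : Dec P) {z} → (P → z ≡ 1ℤ) → (¬ P → z ≡ -1ℤ) → decSign P? ≡ z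
decSign-elim (yes p) pos neg = sym (pos p)
decSign-elim (no ¬p) pos neg = sym (neg ¬p)

rankSign : List ℕ → ℤ
rankSign ps = decSign (evenRank? ps)

rankSign≡ : ∀ ps → rankSign ps ≡ -1ℤ ^ sum ps * pairSign ps
rankSign≡ ps = trans parity
  (trans (^-distribˡ-+-* -1ℤ (r ps) (sum ps)) (*-comm (-1ℤ ^ r ps) (-1ℤ ^ sum ps)))
  where
  d = + (r ps ℕ.+ sum ps) - pairingRank ps
  rank+difference : pairingRank ps + d ≡ + (r ps ℕ.+ sum ps)
  rank+difference = cancel (pairingRank ps) (+ (r ps ℕ.+ sum ps))
    where
    cancel : ∀ a b → a + (b - a) ≡ b
    cancel = solve-∀
  total-difference : + (r ps ℕ.+ sum ps) - d ≡ pairingRank ps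
  total-difference = cancel (pairingRank ps) (+ (r ps ℕ.+ sum ps))
    where
    cancel : ∀ a b → b - (b - a) ≡ a
    cancel = solve-∀
  parity : rankSign ps ≡ -1ℤ ^ (r ps ℕ.+ sum ps)
  parity = decSign-elim (evenRank? ps)
    (λ even → -1^even _ (∣⇒∣ᵤ {+ 2} {+ (r ps ℕ.+ sum ps)} (subst (+ 2 ∣_) rank+difference
          (∣m∣n⇒∣m+n (∣ᵤ⇒∣ {+ 2} {pairingRank ps} even) (r+sum-pairingRank ps)))))
    (λ odd → -1^odd _ λ even → odd (∣⇒∣ᵤ {+ 2} {pairingRank ps} (subst (+ 2 ∣_) total-difference
          (∣m∣n⇒∣m-n (∣ᵤ⇒∣ {+ 2} {+ (r ps ℕ.+ sum ps)} even) (r+sum-pairingRank ps)))))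

count-difference : ∀ {A : Set} {P : Pred A 0ℓ} (P? : Decidable P) xs →
  + length (filter P? xs) - + length (filter (¬? ∘ P?) xs) ≡ ∑ (λ x → decSign (P? x)) xs
count-difference P? []       = refl
count-difference P? (x ∷ xs) with P? x
... | yes _ = trans (add (+ length (filter P? xs)) (+ length (filter (¬? ∘ P?) xs))) (cong (λ z → 1ℤ + z) (count-difference P? xs))
  where
  add : ∀ a b → 1ℤ + a - b ≡ 1ℤ + (a - b)
  add = solve-∀
... | no _  = trans (subtract (+ length (filter P? xs)) (+ length (filter (¬? ∘ P?) xs))) (cong (λ z → -1ℤ + z) (count-difference P? xs))
  where
  subtract : ∀ a b → a - (1ℤ + b) ≡ -1ℤ + (a - b)
  subtract = solve-∀

E-O : ∀ n → + E n - + O n ≡ -1ℤ ^ n * ∑ pairSign (partitions n)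
E-O n = begin
  + E n - + O n
    ≡⟨ count-difference evenRank? (partitions n) ⟩
  ∑ rankSign (partitions n)
    ≡⟨ ∑-cong-local (λ {ps} ps∈ → trans (rankSign≡ ps)
         (cong (λ i → -1ℤ ^ i * pairSign ps) (sum≡n ps∈))) ⟩
  ∑ (λ ps → -1ℤ ^ n * pairSign ps) (partitions n)
    ≡⟨ ∑-* (-1ℤ ^ n) pairSign (partitions n) ⟩
  -1ℤ ^ n * ∑ pairSign (partitions n)
    ∎
  where
  sum≡n : ∀ {ps} → ps ∈ partitions n → sum ps ≡ n
  sum≡n ps∈ = proj₂ (proj₂ (Equivalence.to (∈-partitions {n}) ps∈))

-- Self-conjugate partitions

part : List ℕ → ℕ → ℕ
part []       _       = 0
part (x ∷ xs) zero    = x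
part (x ∷ xs) (suc i) = part xs i

part-≤ : ∀ {v ps} → All (_≤ v) ps → ∀ i → part ps i ≤ v
part-≤ []       _       = z≤n
part-≤ (p ∷ _)  zero    = p
part-≤ (_ ∷ ps) (suc i) = part-≤ ps i

part-≤-head : ∀ {ps} → Linked _≥_ ps → ∀ i → part ps i ≤ part ps 0
part-≤-head {[]}    _ _ = z≤n
part-≤-head {_ ∷ _} l i = part-≤ (ℕ.≤-refl ∷ head≥ l) i

part-suc-≤ : ∀ {ps} → Linked _≥_ ps → ∀ i → part ps (suc i) ≤ part ps i
part-suc-≤ {[]}     _ _       = z≤n
part-suc-≤ {_ ∷ _}  l zero    = part-≤-head l 1
part-suc-≤ {_ ∷ ps} l (suc i) = part-suc-≤ (Linked.tail l) i

part-positive : ∀ {ps} → All (0 <_) ps → ∀ {i} → i < length ps → 0 < part ps i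
part-positive (p ∷ _)   {zero}  _       = p
part-positive (_ ∷ pos) {suc i} (s≤s i<) = part-positive pos i<

part-ext : ∀ {ps qs} → All (0 <_) ps → All (0 <_) qs → part ps ≗ part qs → ps ≡ qs
part-ext []          []          eq = refl
part-ext []          (0<q ∷ _)   eq = ⊥-elim (ℕ.<⇒≢ 0<q (eq 0))
part-ext (0<p ∷ _)   []          eq = ⊥-elim (ℕ.<⇒≢ 0<p (sym (eq 0)))
part-ext (_ ∷ ps)    (_ ∷ qs)    eq = cong₂ _∷_ (eq 0) (part-ext ps qs (eq ∘ suc))

part-applyUpTo-< : ∀ f {n i} → i < n → part (applyUpTo f n) i ≡ f i
part-applyUpTo-< f {suc n} {zero}  _        = refl
part-applyUpTo-< f {suc n} {suc i} (s≤s i<n) = part-applyUpTo-< (f ∘ suc) i<n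

part-applyUpTo-≥ : ∀ f {n i} → n ≤ i → part (applyUpTo f n) i ≡ 0
part-applyUpTo-≥ f {zero}          _         = refl
part-applyUpTo-≥ f {suc n} {suc i} (s≤s n≤i) = part-applyUpTo-≥ (f ∘ suc) n≤i

max≡part₀ : ∀ {ps} → Linked _≥_ ps → max 0 ps ≡ part ps 0
max≡part₀ {[]}    _ = refl
max≡part₀ {_ ∷ _} l = max≈v⁺ (here refl) (ℕ.≤-refl ∷ head≥ l) z≤n

-- In a weakly decreasing list the parts larger than `i` form an initial segment, so index `j` lies
-- in it exactly when their number exceeds `j`.
<-count : ∀ {ps} → Linked _≥_ ps → ∀ i j →
  (j < length (filter (suc i ℕ.≤?_) ps) → i < part ps j) × (i < part ps j → j < length (filter (suc i ℕ.≤?_) ps))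
<-count {[]}     _ i j = (λ ()) , (λ ())
<-count {x ∷ ps} l i j with suc i ℕ.≤? x
... | no  i≮x rewrite filter-reject (suc i ℕ.≤?_) {xs = ps} i≮x
                    | filter-none (suc i ℕ.≤?_) (All.map (λ y≤x i<y → i≮x (ℕ.≤-trans i<y y≤x)) (head≥ l)) =
  (λ ()) , λ i< → ⊥-elim (i≮x (ℕ.≤-trans i< (part-≤-head l j)))
<-count {x ∷ ps} l i zero    | yes i<x rewrite filter-accept (suc i ℕ.≤?_) {xs = ps} i<x = (λ _ → i<x) , λ _ → s≤s z≤n
<-count {x ∷ ps} l i (suc j) | yes i<x rewrite filter-accept (suc i ℕ.≤?_) {xs = ps} i<x =
  let to , from = <-count (Linked.tail l) i j in to ∘ ℕ.≤-pred , s≤s ∘ from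

conjugate-< : ∀ {ps} → Linked _≥_ ps → ∀ i j →
  (j < part (conjugate ps) i → i < part ps j) × (i < part ps j → j < part (conjugate ps) i)
conjugate-< {ps} l i j with i ℕ.<? max 0 ps
... | yes i<max rewrite part-applyUpTo-< (λ i → length (filter (suc i ℕ.≤?_) ps)) i<max = <-count l i j
... | no  i≮max rewrite part-applyUpTo-≥ (λ i → length (filter (suc i ℕ.≤?_) ps)) (ℕ.≮⇒≥ i≮max) =
  (λ ()) , λ i< → ⊥-elim (i≮max (ℕ.<-≤-trans i<
    (ℕ.≤-trans (part-≤-head l j) (ℕ.≤-reflexive (sym (max≡part₀ l))))))

-- The cell (i , j) lies in the Young diagram of ps when j < part ps i.
SymmetricDiagram : List ℕ → Set
SymmetricDiagram ps = ∀ i j → i < part ps j → j < part ps i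

selfConjugate⇒symmetric : ∀ {ps} → Linked _≥_ ps → SelfConjugate ps → SymmetricDiagram ps
selfConjugate⇒symmetric l sc i j = subst (λ qs → j < part qs i) sc ∘ proj₂ (conjugate-< l i j)

<-ext : ∀ {a b} → (∀ i → i < a → i < b) → a ≤ b
<-ext {zero}  _ = z≤n
<-ext {suc a} f = f a ℕ.≤-refl

symmetric⇒selfConjugate : ∀ {ps} → Linked _≥_ ps → All (0 <_) ps → SymmetricDiagram ps → SelfConjugate ps
symmetric⇒selfConjugate {ps} l pos sym-ps = part-ext conjugate-pos pos λ i → ℕ.≤-antisym
  (<-ext λ j j< → sym-ps i j (proj₁ (conjugate-< l i j) j<))
  (<-ext λ j j< → proj₂ (conjugate-< l i j) (sym-ps j i j<))
  where
  conjugate-pos : All (0 <_) (conjugate ps)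
  conjugate-pos = All.applyUpTo⁺₁ _ (max 0 ps) λ {i} i<max →
    proj₂ (<-count l i 0) (subst (i <_) (max≡part₀ l) i<max)

-- A nonempty row of index `m` would, by reflection, give the first row a cell in column `m`.
symmetric⇒length≤ : ∀ {m ps} → All (0 <_) ps → All (_≤ m) ps → SymmetricDiagram ps → length ps ≤ m
symmetric⇒length≤ {m} pos ps≤m sym-ps = ℕ.≮⇒≥ λ m<length →
  ℕ.<⇒≱ (sym-ps 0 m (part-positive pos m<length)) (part-≤ ps≤m 0)

-- Adds a hook with arm and leg of length m around the diagram of a partition with at most m
-- parts, all at most m; core recovers that partition from the rows below the first.
hookRow : ℕ → List ℕ → ℕ → ℕ
hookRow m ps zero    = suc m
hookRow m ps (suc i) = suc (part ps i)

hook : ℕ → List ℕ → List ℕ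
hook m ps = applyUpTo (hookRow m ps) (suc m)

core : List ℕ → List ℕ
core (suc (suc x) ∷ xs) = suc x ∷ core xs
core (suc zero ∷ xs)    = []
core (zero ∷ xs)        = []
core []                 = []

core-hook : ∀ {m ps} → All (0 <_) ps → length ps ≤ m → core (drop 1 (hook m ps)) ≡ ps
core-hook {zero}  {[]}         _           _         = refl
core-hook {suc m} {[]}         _           _         = refl
core-hook {suc m} {suc x ∷ ps} (_ ∷ pos) (s≤s len) = cong (suc x ∷_) (core-hook pos len)

sum-hook : ∀ {m} ps → length ps ≤ m → sum (hook m ps) ≡ odd m ℕ.+ sum ps
sum-hook {m} ps len = cong suc (trans (cong (m ℕ.+_) (rows ps len))
  (trans (sym (ℕ.+-assoc m m _)) (cong (ℕ._+ sum ps) (n+n≡n*2 m))))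
  where
  rows : ∀ {m} ps → length ps ≤ m → sum (applyUpTo (suc ∘ part ps) m) ≡ m ℕ.+ sum ps
  rows {zero}  []       _         = refl
  rows {suc m} []       _         = cong suc (rows {m} [] z≤n)
  rows {suc m} (p ∷ ps) (s≤s len) = cong suc (trans (cong (p ℕ.+_) (rows ps len)) (+.x∙yz≈y∙xz p m _))

hook-sorted : ∀ {m ps} → Linked _≥_ ps → All (_≤ m) ps → Linked _≥_ (hook m ps)
hook-sorted {m} {ps} l ps≤m = Linked.applyUpTo⁺₁ (hookRow m ps) (suc m) decreasing
  where
  decreasing : ∀ {i} → suc i < suc m → hookRow m ps (suc i) ≤ hookRow m ps i
  decreasing {zero}  _ = s≤s (part-≤ ps≤m 0)
  decreasing {suc i} _ = s≤s (part-suc-≤ l i)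

hook-positive : ∀ m ps → All (0 <_) (hook m ps)
hook-positive m ps = All.applyUpTo⁺₂ (hookRow m ps) (suc m) λ { zero → s≤s z≤n ; (suc i) → s≤s z≤n }

hook-≤ : ∀ {m ps} → All (_≤ m) ps → All (_≤ suc m) (hook m ps)
hook-≤ {m} {ps} ps≤m = All.applyUpTo⁺₂ (hookRow m ps) (suc m) λ
  { zero → ℕ.≤-refl ; (suc i) → s≤s (part-≤ ps≤m i) }

hook-symmetric : ∀ {m ps} → All (_≤ m) ps → SymmetricDiagram ps → SymmetricDiagram (hook m ps)
hook-symmetric {m} {ps} ps≤m sym-ps i j i< with j ℕ.<? suc m
... | no j≮ = ⊥-elim (ℕ.<⇒≱ i< (ℕ.≤-trans (ℕ.≤-reflexive (part-applyUpTo-≥ (hookRow m ps) (ℕ.≮⇒≥ j≮))) z≤n))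
... | yes j<1+m = transpose i j j<1+m (subst (i <_) (part-applyUpTo-< (hookRow m ps) j<1+m) i<)
  where
  row : ∀ {i} → i < suc m → hookRow m ps i ≡ part (hook m ps) i
  row = sym ∘ part-applyUpTo-< (hookRow m ps)
  transpose : ∀ i j → j < suc m → i < hookRow m ps j → j < part (hook m ps) i
  transpose zero    j       j< i< = j<
  transpose (suc i) zero    j< i< = subst (0 <_) (row i<) (s≤s z≤n)
  transpose (suc i) (suc j) j< (s≤s i<) =
    subst (suc j <_) (row (s≤s (ℕ.<-≤-trans i< (part-≤ ps≤m j)))) (s≤s (sym-ps i j i<))

core-≤ : ∀ {v xs} → All (_≤ suc v) xs → All (_≤ v) (core xs)
core-≤ []                                    = []
core-≤ {xs = zero ∷ _}        _              = []
core-≤ {xs = suc zero ∷ _}    _              = []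
core-≤ {xs = suc (suc _) ∷ _} (s≤s x≤ ∷ xs≤) = x≤ ∷ core-≤ xs≤

core-sorted : ∀ {xs} → Linked _≥_ xs → Linked _≥_ (core xs)
core-sorted {[]}              _ = []
core-sorted {zero ∷ _}        _ = []
core-sorted {suc zero ∷ _}    _ = []
core-sorted {suc (suc _) ∷ _} l = Linked-∷ (core-≤ (head≥ l)) (core-sorted (Linked.tail l))

core-positive : ∀ xs → All (0 <_) (core xs)
core-positive []                 = []
core-positive (zero ∷ _)         = []
core-positive (suc zero ∷ _)     = []
core-positive (suc (suc _) ∷ xs) = s≤s z≤n ∷ core-positive xs

-- `core` stops at the first part that is at most 1; by sortedness all later parts are at most 1
-- too, so their predecessors are the default value 0.
part-core : ∀ {xs} → Linked _≥_ xs → part (core xs) ≗ pred ∘ part xs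
part-core {[]}               l i       = refl
part-core {zero ∷ xs}        l i       = sym (ℕ.n≤0⇒n≡0 (ℕ.pred-mono-≤ (ℕ.m≤n⇒m≤1+n (part-≤-head l i))))
part-core {suc zero ∷ xs}    l i       = sym (ℕ.n≤0⇒n≡0 (ℕ.pred-mono-≤ (part-≤-head l i)))
part-core {suc (suc x) ∷ xs} l zero    = refl
part-core {suc (suc x) ∷ xs} l (suc i) = part-core (Linked.tail l) i

suc-<-pred : ∀ {i n} → (suc i < n → i < pred n) × (i < pred n → suc i < n)
suc-<-pred {n = zero}  = (λ ()) , (λ ())
suc-<-pred {n = suc n} = ℕ.≤-pred , s≤s

core-symmetric : ∀ {x xs} → Linked _≥_ xs → SymmetricDiagram (x ∷ xs) → SymmetricDiagram (core xs)
core-symmetric l sym-ps i j i< =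
  subst (j <_) (sym (part-core l i)) (proj₁ suc-<-pred
    (sym-ps (suc i) (suc j) (proj₂ suc-<-pred (subst (i <_) (part-core l j) i<))))

-- Symmetry makes the first column as long as the first row: the rows of `xs` with index below `m`
-- are nonempty, so decrementing and incrementing restores them, and the later ones are empty.
hook-core : ∀ {m xs} → IsPartition (suc m ℕ.+ sum xs) (suc m ∷ xs) → SymmetricDiagram (suc m ∷ xs) →
            hook m (core xs) ≡ suc m ∷ xs
hook-core {m} {xs} (l , pos , _) sym-ps = part-ext (hook-positive m (core xs)) pos rows
  where
  rows : part (hook m (core xs)) ≗ part (suc m ∷ xs)
  rows zero = refl
  rows (suc i) with i ℕ.<? m
  ... | yes i<m = begin
    part (hook m (core xs)) (suc i)  ≡⟨ part-applyUpTo-< (hookRow m (core xs)) (s≤s i<m) ⟩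
    suc (part (core xs) i)           ≡⟨ cong suc (part-core (Linked.tail l) i) ⟩
    suc (pred (part xs i))           ≡⟨ ℕ.suc-pred (part xs i) {{ℕ.>-nonZero (sym-ps (suc i) 0 (s≤s i<m))}} ⟩
    part xs i                        ∎
  ... | no i≮m  = trans (part-applyUpTo-≥ (hookRow m (core xs)) (s≤s (ℕ.≮⇒≥ i≮m)))
    (sym (ℕ.n≤0⇒n≡0 (ℕ.≮⇒≥ λ 0<part → i≮m (ℕ.≤-pred (sym-ps 0 (suc i) 0<part)))))

-- Counting self-conjugate partitions by their hooks

selfConjugates : ℕ → ℕ → List (List ℕ)
selfConjugates m n = filter selfConjugate? (boundedPartitions m n)

∈-selfConjugates⁻ : ∀ m n {ps} → ps ∈ selfConjugates m n →
                    IsPartition n ps × All (_≤ m) ps × SymmetricDiagram ps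
∈-selfConjugates⁻ m n ps∈ =
  let ps∈′ , sc = ∈-filter⁻ selfConjugate? {xs = boundedPartitions m n} ps∈
      isP , ps≤m = ∈-bounded⁻ {m} {n} ps∈′
  in isP , ps≤m , selfConjugate⇒symmetric (proj₁ isP) sc

∈-selfConjugates⁺ : ∀ {m n ps} → IsPartition n ps → All (_≤ m) ps → SymmetricDiagram ps →
                    ps ∈ selfConjugates m n
∈-selfConjugates⁺ isP@(l , pos , _) ps≤m sym-ps =
  ∈-filter⁺ selfConjugate? (∈-bounded⁺ isP ps≤m) (symmetric⇒selfConjugate l pos sym-ps)

selfConjugates-unique : ∀ m n → Unique (selfConjugates m n)
selfConjugates-unique m n = Unique.filter⁺ selfConjugate? (bounded-unique m n)

-- If the largest part is m+1, the outer hook has 2m+1 cells and the remaining diagram has parts at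
-- most m. The bound drops, unlike in `bounded-suc`, so each odd hook size is used at most once and
-- the recursion yields a product.
selfConjugates-suc : ∀ m n → selfConjugates (suc m) n ↭
                     selfConjugates m n ++ map (hook m) (shift [] (odd m) (selfConjugates m) n)
selfConjugates-suc m n = unique-↭ (selfConjugates-unique (suc m) n)
  (Unique.++⁺ (selfConjugates-unique m n) hooks-unique disjoint) split join
  where
  smaller = shift [] (odd m) (selfConjugates m) n
  core∘hook : ∀ {ps} → ps ∈ smaller → core (drop 1 (hook m ps)) ≡ ps
  core∘hook ps∈ =
    let j , _ , ps∈′ = ∈-shift⁻ (odd m) n ps∈
        (_ , pos , _) , ps≤m , sym-ps = ∈-selfConjugates⁻ m j ps∈′
    in core-hook pos (symmetric⇒length≤ pos ps≤m sym-ps)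
  hooks-unique : Unique (map (hook m) smaller)
  -- `hook m` truncates long lists, so it is injective only where `core` inverts it; uniqueness is
  -- pulled back along this left inverse.
  hooks-unique = Unique.map⁻ {f = core ∘ drop 1} (subst Unique
    (sym (trans (sym (map-∘ smaller)) (map-id-local (All.tabulate core∘hook))))
    (shift-preserves Unique [] (selfConjugates-unique m) (odd m) n))
  disjoint : ∀ {ps} → ¬ (ps ∈ selfConjugates m n × ps ∈ map (hook m) smaller)
  disjoint (ps∈ , ps∈′) with ∈-map⁻ (hook m) ps∈′
  ... | _ , _ , refl = ℕ.1+n≰n (All.head (proj₁ (proj₂ (∈-selfConjugates⁻ m n ps∈))))
  split : ∀ {ps} → ps ∈ selfConjugates (suc m) n → ps ∈ selfConjugates m n ++ map (hook m) smaller
  split {[]}     ps∈ = ∈-++⁺ˡ (∈-selfConjugates⁺ (proj₁ (∈-selfConjugates⁻ (suc m) n ps∈)) [] (λ _ _ ()))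
  split {x ∷ xs} ps∈ with ∈-selfConjugates⁻ (suc m) n ps∈
  ... | isP@(l , (_ ∷ pos) , refl) , x≤ ∷ xs≤ , sym-ps with x ℕ.≟ suc m
  ...   | no x≢    = let x≤m = ℕ.≤-pred (ℕ.≤∧≢⇒< x≤ x≢) in
    ∈-++⁺ˡ (∈-selfConjugates⁺ isP (x≤m ∷ All.map (λ y≤x → ℕ.≤-trans y≤x x≤m) (head≥ l)) sym-ps)
  ...   | yes refl = ∈-++⁺ʳ (selfConjugates m n) (subst (_∈ map (hook m) smaller) hook≡
    (∈-map⁺ (hook m) (∈-shift⁺ (odd m)
      (trans (sym (sum-hook (core xs) (symmetric⇒length≤ core-pos core≤ core-sym))) (cong sum hook≡))
      (∈-selfConjugates⁺ (core-sorted (Linked.tail l) , core-pos , refl) core≤ core-sym))))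
    where
    core-pos = core-positive xs
    core≤    = core-≤ xs≤
    core-sym = core-symmetric (Linked.tail l) sym-ps
    hook≡    = hook-core isP sym-ps
  join : ∀ {ps} → ps ∈ selfConjugates m n ++ map (hook m) smaller → ps ∈ selfConjugates (suc m) n
  join ps∈ with ∈-++⁻ (selfConjugates m n) ps∈
  ... | inj₁ ps∈ˡ = let isP , ps≤m , sym-ps = ∈-selfConjugates⁻ m n ps∈ˡ in
                    ∈-selfConjugates⁺ isP (All.map ℕ.m≤n⇒m≤1+n ps≤m) sym-ps
  ... | inj₂ ps∈ʳ with ∈-map⁻ (hook m) ps∈ʳ
  ...   | qs , qs∈ , refl =
    let j , eq , qs∈′ = ∈-shift⁻ (odd m) n qs∈
        (l , pos , sum≡j) , qs≤m , sym-qs = ∈-selfConjugates⁻ m j qs∈′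
        length≤m = symmetric⇒length≤ pos qs≤m sym-qs
    in ∈-selfConjugates⁺
         (hook-sorted l qs≤m , hook-positive m qs ,
          trans (sum-hook qs length≤m) (trans (cong (odd m ℕ.+_) sum≡j) eq))
         (hook-≤ qs≤m) (hook-symmetric qs≤m sym-qs)

selfConjugateSeries : ℕ → Series
selfConjugateSeries m n = ∑ (const 1ℤ) (selfConjugates m n)

selfConjugateSeries≗∏odd : ∀ m → selfConjugateSeries m ≗ ∏[1+q^ odd ]^ m · partitionSeries 0
selfConjugateSeries≗∏odd zero n =
  cong (∑ (const 1ℤ)) (filter-all selfConjugate? (All.tabulate empty))
  where
  empty : ∀ {ps} → ps ∈ boundedPartitions 0 n → SelfConjugate ps
  empty {[]}    _   = refl
  empty {_ ∷ _} ps∈ with ∈-bounded⁻ {0} {n} ps∈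
  ... | (_ , 0<p ∷ _ , _) , p≤0 ∷ _ = ⊥-elim (ℕ.<⇒≱ 0<p p≤0)
selfConjugateSeries≗∏odd (suc m) n = begin
  ∑ (const 1ℤ) (selfConjugates (suc m) n)
    ≡⟨ ∑-↭ (const 1ℤ) (selfConjugates-suc m n) ⟩
  ∑ (const 1ℤ) (selfConjugates m n ++ map (hook m) smaller)
    ≡⟨ ∑-++ (const 1ℤ) (selfConjugates m n) _ ⟩
  selfConjugateSeries m n + ∑ (const 1ℤ) (map (hook m) smaller)
    ≡⟨ cong (λ z → selfConjugateSeries m n + z)
         (trans (∑-map (const 1ℤ) (hook m) smaller) (∑-shift (const 1ℤ) (selfConjugates m) (odd m) n)) ⟩
  (1+q^ odd m · selfConjugateSeries m) n
    ≡⟨ 1+q^-≗ (odd m) (selfConjugateSeries≗∏odd m) n ⟩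
  (∏[1+q^ odd ]^ suc m · partitionSeries 0) n
    ∎
  where
  smaller = shift [] (odd m) (selfConjugates m) n

∑-pairSign : ∀ n → ∑ pairSign (partitions n) ≡ + sc n
∑-pairSign n = begin
  ∑ pairSign (partitions n)
    -- Any bound from n on admits all partitions of n; 2n is the one for which `G₀≈∏odd` yields n
    -- odd factors.
    ≡⟨ cong (∑ pairSign) (bounded-≥ n≤n*2) ⟨
  pairSignSeries (n ℕ.* 2) n
    ≡⟨ pairSignSeries≗G (n ℕ.* 2) n ⟩
  G 0 (n ℕ.* 2) n
    ≡⟨ G₀≈∏odd n n n≤n*2 ⟩
  (∏[1+q^ odd ]^ n · partitionSeries 0) n
    ≡⟨ selfConjugateSeries≗∏odd n n ⟨
  ∑ (const 1ℤ) (filter selfConjugate? (boundedPartitions n n))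
    ≡⟨ cong (λ pss → ∑ (const 1ℤ) (filter selfConjugate? pss)) (bounded-≥ (ℕ.≤-refl {n})) ⟩
  ∑ (const 1ℤ) (filter selfConjugate? (partitions n))
    ≡⟨ ∑-1 (filter selfConjugate? (partitions n)) ⟩
  + sc n
    ∎
  where
  n≤n*2 = ℕ.m≤m*n n 2

theorem3p1 : (n : ℕ) → + E n - + O n ≡ -1ℤ ^ n * + sc n
theorem3p1 n = trans (E-O n) (cong (λ z → -1ℤ ^ n * z) (∑-pairSign n))
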